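{- With $m$ and $L$ constants, the data-independent algorithm (described in the context), for a dataset $D\subseteq\mathbb{R}^d$ of $n$ points, requires $O(n)$ space in addition to the space used to store the data.
   Context: Data structure construction: given $D=\{p^1,\ldots,p^n\}\subseteq\mathbb{R}^d$ and positive integers $m$ (number of simple indices per composite index) and $L$ (number of composite indices), draw $mL$ independent uniformly random unit vectors $u_{jl}\in\mathbb{R}^d$, $j\in[m]$, $l\in[L]$, where $[N]=\{1,\ldots,N\}$. For each $j,l$, the simple index $T_{jl}$ is a self-balancing binary search tree or skip list storing the pairs $(\langle p^i,u_{jl}\rangle,i)$, $i\in[n]$, with $\langle p^i,u_{jl}\rangle$ being the key and $i$ the value. The construction procedure returns $\{(T_{jl},u_{jl})\}_{j\in[m],l\in[L]}$. The $l$-th composite index consists of $T_{1l},\ldots,T_{ml}$ and is not explicitly constructed. Query: given a query point $q\in\mathbb{R}^d$, a number $k$ of neighbours to retrieve and a preset number of iterations $\tilde{k}$, initialize for each $l\in[L]$ an array $C_l$ of size $n$ with all entries $0$ and a set $S_l=\emptyset$, and compute $\overline{q}_{jl}=\langle q,u_{jl}\rangle$ for all $j\in[m]$, $l\in[L]$. For $i=1,\ldots,\tilde{k}$ and each $l\in[L]$: for each $j\in[m]$ let $h_{jl}^{(i)}$ be the value of the node in $T_{jl}$ whose key is the $i$-th closest to $\overline{q}_{jl}$, and increment $C_l[h_{jl}^{(i)}]$ by $1$; then add to $S_l$ each $h_{jl}^{(i)}$, $j\in[m]$, with $C_l[h_{jl}^{(i)}]=m$. At the end, return the $k$ points in $\bigcup_{l\in[L]}S_l$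 that are closest to $q$ in Euclidean distance. -}

module Defs where

open import Algebra.Structures using (IsCommutativeRing)
open import Data.Bool.Base using (Bool; true; false; if_then_else_)
open import Data.Fin.Base using (Fin)
import Data.Fin.Properties as Fin
open import Data.List.Base as List
  using (List; []; _∷_; [_]; _++_; allFin; cartesianProduct; concatMap; drop;
         foldl; head; length; take; upTo)
open import Data.List.Extrema.Nat using (max)
open import Data.List.Scans.Base using (scanl)
open import Data.List.Sort using (sort)
open import Data.Maybe.Base as Maybe using (Maybe; just; nothing)
open import Data.Nat.Base using (ℕ; zero; suc; _+_; _*_; _≤_)
open import Data.Nat.ListAction using (sum)
open import Data.Nat.Properties using (_≟_)
open import Data.Product.Base using (Σ-syntax; _×_; _,_; proj₁; proj₂)
open import Data.Product.Relation.Binary.Lex.Strict using (×-strictTotalOrder)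
import Data.Tree.AVL.Indexed as AVLIndexed
import Data.Tree.AVL as AVL
import Data.Tree.AVL.Sets as AVLSets
open import Data.Unit.Base using (⊤; tt)
open import Data.Vec.Base as Vec using (Vec; []; _∷_; lookup; replicate; updateAt; _[_]≔_)
open import Level using (Level) renaming (suc to lsuc; _⊔_ to _⊔ˡ_)
open import Relation.Binary.Bundles using (DecTotalOrder; StrictTotalOrder)
import Relation.Binary.Construct.On as On
import Relation.Binary.Properties.DecTotalOrder as DecTotalOrderProperties
open import Relation.Binary.Structures using (IsDecTotalOrder)
open import Relation.Nullary.Decidable.Core using (does)
open import Relation.Nullary.Negation.Core using (¬_)

import Data.List.Membership.DecPropositional as DecMembership

private
  variable
    c ℓ₁ ℓ₂ t a : Level
    A : Set a

-- The scalars of a real RAM: an ordered field with decidable comparisons in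
-- which non-negative elements have square roots.  ℝ is the intended instance;
-- no further property of ℝ (such as completeness) is assumed.
record EuclideanField c ℓ₁ ℓ₂ : Set (lsuc (c ⊔ˡ ℓ₁ ⊔ˡ ℓ₂)) where
  infix  8 -_
  infixl 7 _·_
  infixl 6 _⊕_
  infix  4 _≈_ _≼_
  field
    Carrier           : Set c
    _≈_               : Carrier → Carrier → Set ℓ₁
    _≼_               : Carrier → Carrier → Set ℓ₂
    _⊕_ _·_           : Carrier → Carrier → Carrier
    -_                : Carrier → Carrier
    0# 1#             : Carrier
    √                 : Carrier → Carrier
    isCommutativeRing : IsCommutativeRing _≈_ _⊕_ _·_ -_ 0# 1#
    isDecTotalOrder   : IsDecTotalOrder _≈_ _≼_
    0≉1               : ¬ (0# ≈ 1#)
    inverse           : ∀ x → ¬ (x ≈ 0#) → Σ[ y ∈ Carrier ] (x · y ≈ 1#)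
    ⊕-monoˡ           : ∀ z {x y} → x ≼ y → x ⊕ z ≼ y ⊕ z
    ·-nonNegative     : ∀ {x y} → 0# ≼ x → 0# ≼ y → 0# ≼ x · y
    √-nonNegative     : ∀ {x} → 0# ≼ x → 0# ≼ √ x
    √-square          : ∀ {x} → 0# ≼ x → √ x · √ x ≈ x

  decTotalOrder : DecTotalOrder c ℓ₁ ℓ₂
  decTotalOrder = record { isDecTotalOrder = isDecTotalOrder }

  open IsDecTotalOrder isDecTotalOrder public using (_≤?_)

-- Table m L A holds one A for every (j , l) ∈ [m] × [L], grouped by l.
Table : ℕ → ℕ → Set a → Set a
Table m L A = Vec (Vec A m) L

at : ∀ {m L} → Table m L A → Fin m → Fin L → A
at x j l = lookup (lookup x l) j

modify : ∀ {m L} → Fin m → Fin L → (A → A) → Table m L A → Table m L A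
modify j l f x = updateAt x l (λ row → updateAt row j f)

total : ∀ {m L} → (A → ℕ) → Table m L A → ℕ
total w x = Vec.sum (Vec.map (λ row → Vec.sum (Vec.map w row)) x)

-- All vectors over a finite list of possibilities, each listed once per way
-- of choosing its entries.
vectors : List A → ∀ n → List (Vec A n)
vectors xs zero    = [ [] ]
vectors xs (suc n) = concatMap (λ x → List.map (x ∷_) (vectors xs n)) xs

module _ (F : EuclideanField c ℓ₁ ℓ₂) where

  open EuclideanField F

  Point : ℕ → Set c
  Point d = Vec Carrier d

  ⟨_,_⟩ : ∀ {d} → Point d → Point d → Carrier
  ⟨ x , y ⟩ = Vec.foldr (λ _ → Carrier) _⊕_ 0# (Vec.zipWith _·_ x y)

  ‖_‖ : ∀ {d} → Point d → Carrier
  ‖ x ‖ = √ ⟨ x , x ⟩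

  dist : ∀ {d} → Point d → Point d → Carrier
  dist x y = ‖ Vec.zipWith (λ a b → a ⊕ - b) x y ‖

  UnitVector : ℕ → Set (c ⊔ˡ ℓ₁)
  UnitVector d = Σ[ x ∈ Point d ] (‖ x ‖ ≈ 1#)

  abs : Carrier → Carrier
  abs x = if does (0# ≤? x) then x else - x

  sortBy : (A → Carrier) → List A → List A
  sortBy f = sort (On.decTotalOrder decTotalOrder f)

  -- The pairs (⟨p^i,u⟩ , i).
  Entry : ℕ → Set c
  Entry n = Carrier × Fin n

  -- An implementation of the simple indices over n points.  Coins is the
  -- randomness consumed by one insertion.  All sizes are counted in words of
  -- a real RAM: a scalar, a natural number or a pointer takes one word.
  record SimpleIndex (n : ℕ) t : Set (c ⊔ˡ lsuc t) where
    field
      T       : Set t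
      Coins   : Set
      empty   : T
      insert  : Coins → Entry n → T → T
      entries : T → List (Entry n)
      words   : T → ℕ

  -- Keys are compared first; equal keys are ordered by their values, so
  -- points with equal projections are stored in separate nodes.
  entryOrder : (n : ℕ) → StrictTotalOrder c ℓ₁ (ℓ₁ ⊔ˡ ℓ₂)
  entryOrder n = ×-strictTotalOrder
    (DecTotalOrderProperties.<-strictTotalOrder decTotalOrder)
    (Fin.<-strictTotalOrder n)

  module _ (n : ℕ) where

    private
      module Tree = AVLIndexed (entryOrder n)
      module Sets = AVLSets (entryOrder n)

    -- A node stores its key, its value, two child pointers and its balance.
    nodeWords : ∀ {l u h} → Tree.Tree (Tree.const ⊤) l u h → ℕ
    nodeWords (Tree.leaf _)         = 0
    nodeWords (Tree.node _ lk ku _) = 5 + nodeWords lk + nodeWords ku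

    -- Besides the nodes: the root pointer, and a stack for one root-to-leaf
    -- path, as used by insertions and traversals.
    treeWords : Sets.⟨Set⟩ → ℕ
    treeWords (AVL.tree {h = h} t) = 1 + nodeWords t + h

    balancedTree : SimpleIndex n (c ⊔ˡ ℓ₁ ⊔ˡ ℓ₂)
    balancedTree = record
      { T       = Sets.⟨Set⟩
      ; Coins   = ⊤
      ; empty   = Sets.empty
      ; insert  = λ _ → Sets.insert
      ; entries = Sets.toList
      ; words   = treeWords
      }

  -- A node of a skip list is an entry with its height, the number of levels
  -- it is linked into.  The nodes are listed in the order of the bottom level;
  -- the forward pointers are determined by the heights: at each level below
  -- its height, a node points to the next node of height exceeding that level.
  SkipList : ℕ → Set c
  SkipList n = List (Entry n × ℕ)

  -- One plus the number of heads before the first tails, with at most H flips.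
  height : ∀ {H} → Vec Bool H → ℕ
  height []          = 1
  height (true  ∷ b) = suc (height b)
  height (false ∷ b) = 1

  module _ {n : ℕ} where

    private
      _<ᵉ?_ = StrictTotalOrder._<?_ (entryOrder n)

    skipInsert : Entry n × ℕ → SkipList n → SkipList n
    skipInsert x []       = x ∷ []
    skipInsert x (y ∷ ys) =
      if does (proj₁ y <ᵉ? proj₁ x) then y ∷ skipInsert x ys else x ∷ y ∷ ys

    -- A node stores its key, its value, its height, a backward pointer and one
    -- forward pointer per level.  The header has one pointer per level in use,
    -- and an insertion keeps an array of predecessors of the same length.
    skipWords : SkipList n → ℕ
    skipWords xs = 1 + sum (List.map (λ x → 4 + proj₂ x) xs)
                     + 2 * max 0 (List.map proj₂ xs)

  skipList : (H n : ℕ) → SimpleIndex n c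
  skipList H n = record
    { T       = SkipList n
    ; Coins   = Vec Bool H
    ; empty   = []
    ; insert  = λ b e → skipInsert (e , height b)
    ; entries = List.map proj₁
    ; words   = skipWords
    }

  module Algorithm {n} (I : SimpleIndex n t) {m L d : ℕ}
                   (D : Vec (Point d) n) (u : Table m L (UnitVector d)) where

    private
      module I = SimpleIndex I

    Trees : Set _
    Trees = Table m L I.T

    -- The program's parameters, loop counters and scalar temporaries.
    scalarVariables : ℕ
    scalarVariables = 16

    module Construct (coins : Table m L (Vec I.Coins n)) where

      insertPoint : Trees → Fin m × Fin L × Fin n → Trees
      insertPoint T (j , l , i) =
        modify j l
          (I.insert (lookup (at coins j l) i)
                    (⟨ lookup D i , proj₁ (at u j l) ⟩ , i))
          T

      initial : Trees
      initial = replicate L (replicate m I.empty)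

      schedule : List (Fin m × Fin L × Fin n)
      schedule = cartesianProduct (allFin m)
                   (cartesianProduct (allFin L) (allFin n))

      states : List Trees
      states = scanl insertPoint initial schedule

      final : Trees
      final = foldl insertPoint initial schedule

      words : Trees → ℕ
      words T = total I.words T + scalarVariables

    module Query (T : Trees) (q : Point d) (k k̃ : ℕ) where

      open DecMembership {A = Fin n} Fin._≟_ using (_∈?_)

      record State : Set c where
        field
          q̄          : Table m L Carrier
          C          : Vec (Vec ℕ n) L
          S          : Vec (List (Fin n)) L
          ranking    : List (Entry n)
          h          : Vec (Maybe (Fin n)) m
          candidates : List (Fin n)
          sorted     : List (Fin n)
          output     : List (Fin n)

      open State

      initial : State
      initial = record
        { q̄          = Vec.map (Vec.map (λ v → ⟨ q , proj₁ v ⟩)) u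
        ; C          = replicate L (replicate n 0)
        ; S          = replicate L []
        ; ranking    = []
        ; h          = replicate m nothing
        ; candidates = []
        ; sorted     = []
        ; output     = []
        }

      insertNew : Fin n → List (Fin n) → List (Fin n)
      insertNew x xs = if does (x ∈? xs) then xs else x ∷ xs

      increment : Fin L → Maybe (Fin n) → Vec (Vec ℕ n) L → Vec (Vec ℕ n) L
      increment l nothing  C = C
      increment l (just x) C = updateAt C l (λ row → updateAt row x suc)

      addIfComplete : Fin L → Maybe (Fin n) → State → State
      addIfComplete l nothing  s = s
      addIfComplete l (just x) s =
        if does (lookup (lookup (C s) l) x ≟ m)
        then record s { S = updateAt (S s) l (insertNew x) }
        else s

      -- Iterations are numbered from 0, so visit i looks up the (i+1)-st
      -- closest key; it finds nothing when i ≥ n.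
      data Instruction : Set where
        visit            : ℕ → Fin L → Fin m → Instruction
        collect          : Fin L → Fin m → Instruction
        unite rank yield : Instruction

      step : State → Instruction → State
      step s (visit i l j) =
        record s { ranking = r ; h = h s [ j ]≔ x ; C = increment l x (C s) }
        where
        r = sortBy (λ e → abs (proj₁ e ⊕ - at (q̄ s) j l)) (I.entries (at T j l))
        x = Maybe.map proj₂ (head (drop i r))
      step s (collect l j) = addIfComplete l (lookup (h s) j) s
      step s unite =
        record s { candidates = List.foldr insertNew []
                                  (List.concat (Vec.toList (S s))) }
      step s rank =
        record s { sorted = sortBy (λ i → dist q (lookup D i)) (candidates s) }
      step s yield = record s { output = take k (sorted s) }

      program : List Instruction
      program =
        concatMap (λ i →
          concatMap (λ l → List.map (visit i l) (allFin m)
                        ++ List.map (collect l) (allFin m))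
            (allFin L))
          (upTo k̃)
        ++ unite ∷ rank ∷ yield ∷ []

      states : List State
      states = scanl step initial program

      listWords : List A → ℕ
      listWords xs = 2 * length xs

      -- The indices stay in memory; the ranking has three words per cell.
      words : State → ℕ
      words s = total I.words T
              + total (λ _ → 1) (q̄ s)
              + Vec.sum (Vec.map Vec.length (C s))
              + Vec.sum (Vec.map listWords (S s))
              + 3 * length (ranking s)
              + Vec.length (h s)
              + listWords (candidates s)
              + listWords (sorted s)
              + listWords (output s)
              + scalarVariables

    -- Largest number of words in use during construction and one query, not
    -- counting the dataset, the directions u and the query point.
    workingSpace : Table m L (Vec I.Coins n) → Point d → ℕ → ℕ → ℕ
    workingSpace coins q k k̃ =
      max 0 (List.map B.words B.states ++ List.map R.words R.states)
      where
      module B = Construct coins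
      module R = Query B.final q k k̃

    -- The same, counting also the directions and the query point.
    additionalSpace : Table m L (Vec I.Coins n) → Point d → ℕ → ℕ → ℕ
    additionalSpace coins q k k̃ =
      total (λ v → Vec.length (proj₁ v)) u + Vec.length q
        + workingSpace coins q k k̃

-- The outcomes of H fair coin flips for every insertion, all equally likely.
-- A tower taller than H + 1 is cut off; as H grows the heights approach the
-- geometric distribution.
coinFlips : (H n m L : ℕ) → List (Table m L (Vec (Vec Bool H) n))
coinFlips H n m L = vectors (vectors (vectors (vectors (false ∷ true ∷ []) H) n) m) L

-- The mean of f over equally likely outcomes is at most b.
MeanAtMost : List A → (A → ℕ) → ℕ → Set
MeanAtMost xs f b = sum (List.map f xs) ≤ b * length xs

{-# OPTIONS --safe #-}

-- Give every simple index a potential that bounds both its size in words and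
-- its number of entries, and that an insertion increases by at most a weight
-- depending on its coins.  Over the whole construction the total potential
-- never exceeds m L plus the sum of all weights.  The sets S_l and their union
-- are duplicate-free lists over [n], so a query adds O(n) words whatever k̃ is.
-- The weights are constant for balanced trees, and for skip lists they have
-- constant mean, since a tower has mean height at most 2.
module Submission where

open import Defs
open import Data.Bool.Base using (true; false)
open import Data.Fin.Base using (Fin; zero; suc)
import Data.Fin.Properties as Fin
open import Data.List.Base as List
  using (List; []; _∷_; allFin; cartesianProduct; concatMap; foldl;
         foldr; length; map)
open import Data.List.Extrema.Nat using (max; max≤v⁺)
import Data.List.Membership.DecPropositional as DecMembership
open import Data.List.Membership.Propositional.Properties using (∈-lookup)
open import Data.List.Properties
  using (length-++; length-map; length-tabulate; length-take; map-++; map-cong;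
         map-∘)
open import Data.List.Relation.Binary.Permutation.Propositional.Properties
  using (↭-length)
open import Data.List.Relation.Unary.All as All using (All; []; _∷_)
import Data.List.Relation.Unary.All.Properties as All
open import Data.List.Relation.Unary.AllPairs using ([]; _∷_)
open import Data.List.Relation.Unary.Unique.Propositional using (Unique)
open import Data.List.Scans.Base using (scanl)
open import Data.List.Sort using (sort-↭)
open import Data.Maybe.Base using (just; nothing)
open import Data.Nat.Base using (ℕ; zero; suc; _+_; _*_; _≤_; z≤n; s≤s; NonZero)
open import Data.Nat.ListAction using (sum)
open import Data.Nat.ListAction.Properties using (sum-++)
open import Data.Nat.Properties
open import Data.Nat.Tactic.RingSolver using (solve-∀)
open import Data.Product.Base using (Σ-syntax; _×_; _,_; proj₁; proj₂)
import Data.Tree.AVL as AVL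
import Data.Tree.AVL.Indexed as AVLIndexed
import Data.Tree.AVL.Sets as AVLSets
open import Data.Unit.Base using (⊤)
open import Data.Vec.Base as Vec using (Vec; []; _∷_; lookup; replicate; updateAt)
open import Data.Vec.Relation.Unary.All as VecAll using ([]; _∷_)
open import Function.Base using (_∘_; const)
open import Level using (Level) renaming (_⊔_ to _⊔ˡ_)
open import Relation.Binary.Bundles using (StrictTotalOrder)
open import Relation.Binary.Definitions using (tri<; tri≈; tri>)
open import Relation.Binary.PropositionalEquality
  using (_≡_; refl; sym; trans; cong; cong₂; subst)
open import Relation.Nullary.Decidable.Core using (does; yes; no)
open import Relation.Nullary.Negation.Core using (contradiction)

private
  variable
    a b c ℓ₁ ℓ₂ p t : Level
    A : Set a
    B : Set b

-- Sums over lists.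

sum-map-≤ : ∀ {f g : A → ℕ} → (∀ x → f x ≤ g x) →
            ∀ xs → sum (map f xs) ≤ sum (map g xs)
sum-map-≤ f≤g []       = z≤n
sum-map-≤ f≤g (x ∷ xs) = +-mono-≤ (f≤g x) (sum-map-≤ f≤g xs)

sum-map-const : ∀ k (xs : List A) → sum (map (const k) xs) ≡ k * length xs
sum-map-const k []       = sym (*-zeroʳ k)
sum-map-const k (x ∷ xs) = trans (cong (k +_) (sum-map-const k xs))
                                 (sym (*-suc k (length xs)))

sum-map-*ʳ : ∀ (f : A → ℕ) k xs → sum (map (λ x → f x * k) xs) ≡ sum (map f xs) * k
sum-map-*ʳ f k []       = refl
sum-map-*ʳ f k (x ∷ xs) = trans (cong (f x * k +_) (sum-map-*ʳ f k xs))
                                (sym (*-distribʳ-+ k (f x) (sum (map f xs))))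

sum-map-+ : ∀ (f g : A → ℕ) xs →
            sum (map (λ x → f x + g x) xs) ≡ sum (map f xs) + sum (map g xs)
sum-map-+ f g []       = refl
sum-map-+ f g (x ∷ xs) = trans (cong (f x + g x +_) (sum-map-+ f g xs))
                               (exchange (f x) (g x) _ _)
  where
  exchange : ∀ w x y z → w + x + (y + z) ≡ w + y + (x + z)
  exchange = solve-∀

sum-map-concatMap : ∀ (f : B → ℕ) (g : A → List B) xs →
                    sum (map f (concatMap g xs)) ≡ sum (map (sum ∘ map f ∘ g) xs)
sum-map-concatMap f g []       = refl
sum-map-concatMap f g (x ∷ xs) = trans (cong sum (map-++ f (g x) (concatMap g xs)))
  (trans (sum-++ (map f (g x)) _)
         (cong (sum (map f (g x)) +_) (sum-map-concatMap f g xs)))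

All-≤-sum : ∀ xs → All (_≤ sum xs) xs
All-≤-sum []       = []
All-≤-sum (x ∷ xs) = m≤m+n x (sum xs) ∷
  All.map (λ y≤ → ≤-trans y≤ (m≤n+m (sum xs) x)) (All-≤-sum xs)

-- Bounds on means over equally likely outcomes.

-- A record, since MeanAtMost unfolds to an inequality from which the outcomes
-- and the bound cannot be inferred.
record Mean {A : Set a} (xs : List A) (f : A → ℕ) (k : ℕ) : Set where
  constructor mean
  field
    bound : MeanAtMost xs f k

open Mean

mean-mono : ∀ {xs : List A} {f g k} → (∀ x → f x ≤ g x) → Mean xs g k → Mean xs f k
mean-mono {xs = xs} f≤g (mean mg) = mean (≤-trans (sum-map-≤ f≤g xs) mg)

mean-const : ∀ {xs : List A} k → Mean xs (const k) k
mean-const {xs = xs} k = mean (≤-reflexive (sum-map-const k xs))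

mean-+ : ∀ {xs : List A} {f g k l} → Mean xs f k → Mean xs g l →
         Mean xs (λ x → f x + g x) (k + l)
mean-+ {xs = xs} {f} {g} {k} {l} (mean mf) (mean mg) = mean (begin
  sum (map (λ x → f x + g x) xs)    ≡⟨ sum-map-+ f g xs ⟩
  sum (map f xs) + sum (map g xs)   ≤⟨ +-mono-≤ mf mg ⟩
  k * length xs + l * length xs     ≡⟨ *-distribʳ-+ (length xs) k l ⟨
  (k + l) * length xs               ∎)
  where open ≤-Reasoning

mean-* : ∀ {xs : List A} {f k} j → Mean xs f k → Mean xs (λ x → j * f x) (j * k)
mean-* zero    mf = mean-const 0
mean-* (suc j) mf = mean-+ mf (mean-* j mf)

mean-sum : ∀ {xs : List A} {f : B → A → ℕ} {k} → (∀ s → Mean xs (f s) k) →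
           ∀ ss → Mean xs (λ x → sum (map (λ s → f s x) ss)) (length ss * k)
mean-sum mf []       = mean-const 0
mean-sum mf (s ∷ ss) = mean-+ (mf s) (mean-sum mf ss)

-- The tool for induction on `n`: a sum over a product space is an iterated sum, with the first
-- coordinate outermost.
sum-map-vectors : ∀ n (f : Vec A (suc n) → ℕ) xs →
  sum (map f (vectors xs (suc n))) ≡
  sum (map (λ x → sum (map (λ v → f (x ∷ v)) (vectors xs n))) xs)
sum-map-vectors n f xs = trans
  (sum-map-concatMap f (λ x → map (x ∷_) (vectors xs n)) xs)
  (cong sum (map-cong (λ x → cong sum (sym (map-∘ (vectors xs n)))) xs))

-- Counting is summing the constant 1, so `sum-map-vectors` applies.
length-vectors : ∀ n (xs : List A) →
                 length (vectors xs (suc n)) ≡ length (vectors xs n) * length xs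
length-vectors n xs = trans (length≡sum (vectors xs (suc n)))
  (trans (sum-map-vectors n (const 1) xs)
  (trans (sum-map-const (sum (map (const 1) (vectors xs n))) xs)
         (cong (_* length xs) (sym (length≡sum (vectors xs n))))))
  where
  length≡sum : ∀ {b} {B : Set b} (ys : List B) → length ys ≡ sum (map (const 1) ys)
  length≡sum ys = sym (trans (sum-map-const 1 ys) (*-identityˡ (length ys)))

-- A coordinate of a uniform vector is uniform. For the first coordinate, each value is followed by
-- equally many tails; for a later one, the inductive bound holds below every choice of the first.
-- Iterated, this carries a bound for one insertion to the whole table of coins.
mean-lookup : ∀ {n} {xs : List A} {f k} → Mean xs f k → (i : Fin n) →
              Mean (vectors xs n) (λ v → f (lookup v i)) k
mean-lookup {n = suc n} {xs} {f} {k} (mean mf) zero = mean (begin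
  sum (map (λ v → f (lookup v zero)) (vectors xs (suc n)))
    ≡⟨ sum-map-vectors n _ xs ⟩
  sum (map (λ x → sum (map (const (f x)) V)) xs)
    ≤⟨ sum-map-≤ (λ x → ≤-reflexive (sum-map-const (f x) V)) xs ⟩
  sum (map (λ x → f x * length V) xs)
    ≡⟨ sum-map-*ʳ f (length V) xs ⟩
  sum (map f xs) * length V
    ≤⟨ *-monoˡ-≤ (length V) mf ⟩
  k * length xs * length V
    ≡⟨ *-assoc k (length xs) (length V) ⟩
  k * (length xs * length V)
    ≡⟨ cong (k *_) (trans (*-comm (length xs) (length V)) (sym (length-vectors n xs))) ⟩
  k * length (vectors xs (suc n)) ∎)
  where
  open ≤-Reasoning
  V = vectors xs n
mean-lookup {n = suc n} {xs} {f} {k} mf (suc i) = mean (begin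
  sum (map (λ v → f (lookup v (suc i))) (vectors xs (suc n)))
    ≡⟨ sum-map-vectors n _ xs ⟩
  sum (map (λ _ → sum (map (λ v → f (lookup v i)) V)) xs)
    ≤⟨ sum-map-≤ (λ _ → bound (mean-lookup mf i)) xs ⟩
  sum (map (λ _ → k * length V) xs)
    ≡⟨ sum-map-const (k * length V) xs ⟩
  k * length V * length xs
    ≡⟨ *-assoc k (length V) (length xs) ⟩
  k * (length V * length xs)
    ≡⟨ cong (k *_) (length-vectors n xs) ⟨
  k * length (vectors xs (suc n)) ∎)
  where
  open ≤-Reasoning
  V = vectors xs n

-- Condition on the first flip: tails gives 1, heads gives 1 plus the height from the remaining
-- flips. The value 2 solves x = (1 + (1 + x)) / 2, so it survives the induction for every cut-off
-- `H`.
mean-height : (F : EuclideanField c ℓ₁ ℓ₂) (H : ℕ) →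
              Mean (vectors (false ∷ true ∷ []) H) (height F) 2
mean-height F zero    = mean (s≤s z≤n)
mean-height F (suc H) = mean (begin
  sum (map (height F) (vectors coin (suc H)))
    ≡⟨ sum-map-vectors H (height F) coin ⟩
  sum (map (const 1) V) + (sum (map (λ v → 1 + height F v) V) + 0)
    ≤⟨ +-mono-≤ (bound (mean-const {xs = V} 1)) (+-monoˡ-≤ 0
         (bound (mean-+ (mean-const 1) (mean-height F H)))) ⟩
  1 * length V + (3 * length V + 0)
    ≡⟨ rearrange (length V) ⟩
  2 * (length V * 2)
    ≡⟨ cong (2 *_) (length-vectors H coin) ⟨
  2 * length (vectors coin (suc H)) ∎)
  where
  open ≤-Reasoning
  coin = false ∷ true ∷ []
  V = vectors coin H
  rearrange : ∀ x → 1 * x + (3 * x + 0) ≡ 2 * (x * 2)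
  rearrange = solve-∀

-- Sums and invariants over vectors and tables.

vec-sum-≤ : ∀ {n k} (f : A → ℕ) {xs : Vec A n} →
            VecAll.All (λ x → f x ≤ k) xs → Vec.sum (Vec.map f xs) ≤ n * k
vec-sum-≤ f []         = z≤n
vec-sum-≤ f (fx ∷ fxs) = +-mono-≤ fx (vec-sum-≤ f fxs)

-- Hypothesis and conclusion have the same shape, an additive growth of `k`, so the lemma nests:
-- `total-modify` uses it first inside a row and then on the vector of rows.
vec-sum-updateAt : ∀ {n k} (w : A → ℕ) (f : A → A) → (∀ x → w (f x) ≤ k + w x) →
  ∀ (xs : Vec A n) i →
  Vec.sum (Vec.map w (updateAt xs i f)) ≤ k + Vec.sum (Vec.map w xs)
vec-sum-updateAt {k = k} w f w∘f≤ (x ∷ xs) zero = begin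
  w (f x) + s    ≤⟨ +-monoˡ-≤ s (w∘f≤ x) ⟩
  k + w x + s    ≡⟨ +-assoc k (w x) s ⟩
  k + (w x + s)  ∎
  where
  open ≤-Reasoning
  s = Vec.sum (Vec.map w xs)
vec-sum-updateAt {k = k} w f w∘f≤ (x ∷ xs) (suc i) = begin
  w x + Vec.sum (Vec.map w (updateAt xs i f))
    ≤⟨ +-monoʳ-≤ (w x) (vec-sum-updateAt w f w∘f≤ xs i) ⟩
  w x + (k + s)  ≡⟨ +-comm (w x) (k + s) ⟩
  k + s + w x    ≡⟨ +-assoc k s (w x) ⟩
  k + (s + w x)  ≡⟨ cong (k +_) (+-comm s (w x)) ⟩
  k + (w x + s)  ∎
  where
  open ≤-Reasoning
  s = Vec.sum (Vec.map w xs)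

lookup≤vec-sum : ∀ {n} (w : A → ℕ) (xs : Vec A n) i →
                 w (lookup xs i) ≤ Vec.sum (Vec.map w xs)
lookup≤vec-sum w (x ∷ xs) zero    = m≤m+n (w x) _
lookup≤vec-sum w (x ∷ xs) (suc i) = ≤-trans (lookup≤vec-sum w xs i) (m≤n+m _ (w x))

vec-sum-mono : ∀ {n} {v w : A → ℕ} → (∀ x → v x ≤ w x) → (xs : Vec A n) →
               Vec.sum (Vec.map v xs) ≤ Vec.sum (Vec.map w xs)
vec-sum-mono v≤w []       = z≤n
vec-sum-mono v≤w (x ∷ xs) = +-mono-≤ (v≤w x) (vec-sum-mono v≤w xs)

total-mono : ∀ {m L} {v w : A → ℕ} → (∀ x → v x ≤ w x) → (x : Table m L A) →
             total v x ≤ total w x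
total-mono v≤w = vec-sum-mono (vec-sum-mono v≤w)

total-const : ∀ {m L k} (w : A → ℕ) → (∀ x → w x ≤ k) → (x : Table m L A) →
              total w x ≤ L * (m * k)
total-const w w≤k x = vec-sum-≤ _
  (VecAll.universal (λ row → vec-sum-≤ w (VecAll.universal w≤k row)) x)

total-modify : ∀ {m L k} (w : A → ℕ) (f : A → A) → (∀ x → w (f x) ≤ k + w x) →
               ∀ j l (x : Table m L A) → total w (modify j l f x) ≤ k + total w x
total-modify w f w∘f≤ j l x =
  vec-sum-updateAt _ _ (λ row → vec-sum-updateAt w f w∘f≤ row j) x l

at≤total : ∀ {m L} (w : A → ℕ) (x : Table m L A) j l → w (at x j l) ≤ total w x
at≤total w x j l = ≤-trans (lookup≤vec-sum w (lookup x l) j) (lookup≤vec-sum _ x l)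

All-replicate : ∀ {P : A → Set p} n {x} → P x → VecAll.All P (replicate n x)
All-replicate zero    px = []
All-replicate (suc n) px = px ∷ All-replicate n px

All-updateAt : ∀ {P : A → Set p} {n} {f : A → A} → (∀ {x} → P x → P (f x)) →
               {xs : Vec A n} → VecAll.All P xs → ∀ i → VecAll.All P (updateAt xs i f)
All-updateAt f⁺ (px ∷ pxs) zero    = f⁺ px ∷ pxs
All-updateAt f⁺ (px ∷ pxs) (suc i) = px ∷ All-updateAt f⁺ pxs i

-- Invariants and potentials along a run.

scanl-All : ∀ {P : A → Set p} {f : A → B → A} → (∀ {s} → P s → ∀ x → P (f s x)) →
            ∀ {s} → P s → ∀ xs → All P (scanl f s xs)
scanl-All f⁺ ps []       = ps ∷ []
scanl-All f⁺ ps (x ∷ xs) = ps ∷ scanl-All f⁺ (f⁺ ps x) xs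

module _ {f : A → B → A} {φ : A → ℕ} {w : B → ℕ}
         (φ-step : ∀ s x → φ (f s x) ≤ w x + φ s) where

  private
    -- The amortised quantity: weights still to come plus present potential never increase along the
    -- run.
    spend : ∀ s x xs → sum (map w xs) + φ (f s x) ≤ sum (map w (x ∷ xs)) + φ s
    spend s x xs = begin
      W + φ (f s x)    ≤⟨ +-monoʳ-≤ W (φ-step s x) ⟩
      W + (w x + φ s)  ≡⟨ +-assoc W (w x) (φ s) ⟨
      W + w x + φ s    ≡⟨ cong (_+ φ s) (+-comm W (w x)) ⟩
      w x + W + φ s    ∎
      where
      open ≤-Reasoning
      W = sum (map w xs)

  foldl-potential : ∀ s xs → φ (foldl f s xs) ≤ sum (map w xs) + φ s
  foldl-potential s []       = ≤-refl
  foldl-potential s (x ∷ xs) = ≤-trans (foldl-potential (f s x) xs) (spend s x xs)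

  -- `workingSpace` is a maximum over all states, so the end value alone is not enough. Every state
  -- is charged the weights of the whole run; at the start they are pure slack.
  scanl-potential : ∀ s xs → All (λ s′ → φ s′ ≤ sum (map w xs) + φ s) (scanl f s xs)
  scanl-potential s []       = ≤-refl ∷ []
  scanl-potential s (x ∷ xs) = m≤n+m (φ s) _ ∷
    All.map (λ φ≤ → ≤-trans φ≤ (spend s x xs)) (scanl-potential (f s x) xs)

-- Duplicate-free lists over a finite set.

lookup-injective : ∀ {xs : List A} → Unique xs →
                   ∀ i j → List.lookup xs i ≡ List.lookup xs j → i ≡ j
lookup-injective (x∉ ∷ u) zero    zero    eq = refl
lookup-injective (x∉ ∷ u) zero    (suc j) eq = contradiction eq (All.lookup x∉ (∈-lookup j))
lookup-injective (x∉ ∷ u) (suc i) zero    eq = contradiction (sym eq) (All.lookup x∉ (∈-lookup i))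
lookup-injective (x∉ ∷ u) (suc i) (suc j) eq = cong suc (lookup-injective u i j eq)

-- Pigeonhole: indexing a duplicate-free list is an injection from its positions into `Fin n`.
Unique⇒length≤ : ∀ {n} {xs : List (Fin n)} → Unique xs → length xs ≤ n
Unique⇒length≤ u = Fin.injective⇒≤ (λ {i} {j} → lookup-injective u i j)

-- The number of insertions.

length-cartesianProduct : ∀ (xs : List A) (ys : List B) →
                          length (cartesianProduct xs ys) ≡ length xs * length ys
length-cartesianProduct []       ys = refl
length-cartesianProduct (x ∷ xs) ys = trans (length-++ (map (x ,_) ys))
  (cong₂ _+_ (length-map (x ,_) ys) (length-cartesianProduct xs ys))

-- Definitionally the `schedule` of the construction, but free of the data, the directions and the
-- coins.
insertions : ∀ m L n → List (Fin m × Fin L × Fin n)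
insertions m L n = cartesianProduct (allFin m) (cartesianProduct (allFin L) (allFin n))

length-insertions : ∀ m L n → length (insertions m L n) ≡ m * (L * n)
length-insertions m L n = trans
  (length-cartesianProduct (allFin m) (cartesianProduct (allFin L) (allFin n)))
  (cong₂ _*_ (length-allFin m)
    (trans (length-cartesianProduct (allFin L) (allFin n))
           (cong₂ _*_ (length-allFin L) (length-allFin n))))
  where
  length-allFin : ∀ n → length (allFin n) ≡ n
  length-allFin n = length-tabulate _

-- The coefficient left over in `queryBound-linear`. Of the 5 `m * L`, four come from empty indices
-- in the four copies of `β` and one from `q̄`; `m` is the array `h` and 16 the scalars. Multiplying
-- `n` itself are 3 `L` for the arrays `C` and sets `S`, and 6 for the lists `candidates`, `sorted`
-- and `output`.
overhead : ℕ → ℕ → ℕ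
overhead m L = 5 * (m * L) + m + 16 + (3 * L + 6)

-- Space of construction and query, given a potential.

module _ {F : EuclideanField c ℓ₁ ℓ₂} where

  length-sortBy : (f : A → EuclideanField.Carrier F) (xs : List A) →
                  length (sortBy F f xs) ≡ length xs
  length-sortBy f xs = ↭-length (sort-↭ _ xs)

  -- `weight` sees only the coins, neither the tree nor the entry, so the total weight is a fixed
  -- sum over insertions and its mean follows by linearity. The bound on `entries` is there for the
  -- `ranking` built by a query.
  record Potential {n} (I : SimpleIndex F n t) : Set (c ⊔ˡ t) where
    open SimpleIndex I
    field
      φ                : T → ℕ
      weight           : Coins → ℕ
      φ-empty          : φ empty ≤ 1
      φ-insert         : ∀ r e x → φ (insert r e x) ≤ weight r + φ x
      words≤φ          : ∀ x → words x ≤ φ x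
      length-entries≤φ : ∀ x → length (entries x) ≤ φ x

  module Space {n} {I : SimpleIndex F n t} (P : Potential I) {m L d : ℕ}
               (D : Vec (Point F d) n) (u : Table m L (UnitVector F d)) where

    open SimpleIndex I using (Coins)
    open Potential P
    open Algorithm F I D u

    insertionWeight : Table m L (Vec Coins n) → Fin m × Fin L × Fin n → ℕ
    insertionWeight coins (j , l , i) = weight (lookup (at coins j l) i)

    totalWeight : Table m L (Vec Coins n) → ℕ
    totalWeight coins = sum (map (insertionWeight coins) (insertions m L n))

    module _ (coins : Table m L (Vec Coins n)) where

      open Construct coins

      potentialBound : ℕ
      potentialBound = totalWeight coins + L * (m * 1)

      private
        step-φ : ∀ T x → total φ (insertPoint T x) ≤ insertionWeight coins x + total φ T
        step-φ T (j , l , i) = total-modify φ _ (φ-insert _ _) j l T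

        initial-φ : total φ initial ≤ L * (m * 1)
        initial-φ = vec-sum-≤ _ (All-replicate L (vec-sum-≤ φ (All-replicate m φ-empty)))

      states-φ : All (λ T → total φ T ≤ potentialBound) states
      states-φ = All.map (λ φ≤ → ≤-trans φ≤ (+-monoʳ-≤ (totalWeight coins) initial-φ))
                         (scanl-potential step-φ initial schedule)

      final-φ : total φ final ≤ potentialBound
      final-φ = ≤-trans (foldl-potential step-φ initial schedule)
                        (+-monoʳ-≤ (totalWeight coins) initial-φ)

    module _ (T : Trees) (β : ℕ) (T≤β : total φ T ≤ β) (q : Point F d) (k k̃ : ℕ) where

      open Query T q k k̃
      open State

      -- Only the lists need an invariant, since `q̄`, `C` and `h` have their sizes in their types.
      -- Uniqueness is kept for `S` and `candidates` because, unlike a length bound, it is preserved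
      -- by `insertNew`.
      record Bounded (s : State) : Set where
        field
          S-unique          : VecAll.All Unique (S s)
          ranking≤          : length (ranking s) ≤ β
          candidates-unique : Unique (candidates s)
          sorted≤           : length (sorted s) ≤ n
          output≤           : length (output s) ≤ n

      open Bounded

      insertNew-unique : ∀ x {xs} → Unique xs → Unique (insertNew x xs)
      insertNew-unique x {xs} u with DecMembership._∈?_ Fin._≟_ x xs
      ... | yes _ = u
      ... | no x∉ = All.¬Any⇒All¬ xs x∉ ∷ u

      foldr-insertNew-unique : ∀ xs → Unique (foldr insertNew [] xs)
      foldr-insertNew-unique []       = []
      foldr-insertNew-unique (x ∷ xs) = insertNew-unique x (foldr-insertNew-unique xs)

      initial-bounded : Bounded initial
      initial-bounded = record
        { S-unique          = All-replicate L []
        ; ranking≤          = z≤n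
        ; candidates-unique = []
        ; sorted≤           = z≤n
        ; output≤           = z≤n
        }

      addIfComplete-bounded : ∀ l x {s} → Bounded s → Bounded (addIfComplete l x s)
      addIfComplete-bounded l nothing  bs = bs
      addIfComplete-bounded l (just x) {s} bs
        with does (lookup (lookup (C s) l) x ≟ m)
      ... | true  = record
        { S-unique          = All-updateAt (insertNew-unique x) (S-unique bs) l
        ; ranking≤          = ranking≤ bs
        ; candidates-unique = candidates-unique bs
        ; sorted≤           = sorted≤ bs
        ; output≤           = output≤ bs
        }
      ... | false = bs

      step-bounded : ∀ {s} → Bounded s → ∀ x → Bounded (step s x)
      step-bounded {s} bs (visit i l j) = record
        { S-unique          = S-unique bs
        -- Each visit overwrites the ranking with the entries of a single index, whose potential is
        -- one term of the total.
        ; ranking≤          = ≤-trans (≤-reflexive (length-sortBy _ (SimpleIndex.entries I (at T j l))))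
                                (≤-trans (length-entries≤φ (at T j l))
                                  (≤-trans (at≤total φ T j l) T≤β))
        ; candidates-unique = candidates-unique bs
        ; sorted≤           = sorted≤ bs
        ; output≤           = output≤ bs
        }
      step-bounded {s} bs (collect l j) = addIfComplete-bounded l (lookup (h s) j) bs
      step-bounded {s} bs unite = record
        { S-unique          = S-unique bs
        ; ranking≤          = ranking≤ bs
        ; candidates-unique = foldr-insertNew-unique (List.concat (Vec.toList (S s)))
        ; sorted≤           = sorted≤ bs
        ; output≤           = output≤ bs
        }
      step-bounded {s} bs rank = record
        { S-unique          = S-unique bs
        ; ranking≤          = ranking≤ bs
        ; candidates-unique = candidates-unique bs
        ; sorted≤           = ≤-trans (≤-reflexive (length-sortBy _ (candidates s)))
                                (Unique⇒length≤ (candidates-unique bs))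
        ; output≤           = output≤ bs
        }
      step-bounded {s} bs yield = record
        { S-unique          = S-unique bs
        ; ranking≤          = ranking≤ bs
        ; candidates-unique = candidates-unique bs
        ; sorted≤           = sorted≤ bs
        ; output≤           = ≤-trans (≤-reflexive (length-take k (sorted s)))
                                (≤-trans (m⊓n≤n k _) (sorted≤ bs))
        }

      -- The summands follow those of `words`, in the same order.
      queryBound : ℕ
      queryBound = β + L * (m * 1) + L * n + L * (2 * n) + 3 * β + m
                     + 2 * n + 2 * n + 2 * n + 16

      words-bounded : ∀ {s} → Bounded s → words s ≤ queryBound
      words-bounded {s} bs = +-monoˡ-≤ 16
        (≤-trans (total-mono words≤φ T) T≤β
        ⊕ total-const _ (λ _ → ≤-refl) (q̄ s)
        ⊕ vec-sum-≤ _ (VecAll.universal (λ _ → ≤-refl) (C s))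
        ⊕ vec-sum-≤ _ (VecAll.map (λ u → *-monoʳ-≤ 2 (Unique⇒length≤ u)) (S-unique bs))
        ⊕ *-monoʳ-≤ 3 (ranking≤ bs)
        ⊕ ≤-refl
        ⊕ *-monoʳ-≤ 2 (Unique⇒length≤ (candidates-unique bs))
        ⊕ *-monoʳ-≤ 2 (sorted≤ bs)
        ⊕ *-monoʳ-≤ 2 (output≤ bs))
        where
        infixl 5 _⊕_
        _⊕_ : ∀ {w x y z} → w ≤ x → y ≤ z → w + y ≤ x + z
        _⊕_ = +-mono-≤

      states-words : All (λ s → words s ≤ queryBound) states
      states-words = All.map (λ {s} → words-bounded {s}) (scanl-All step-bounded initial-bounded program)

    private
      queryBound-linear : .{{_ : NonZero n}} → ∀ W →
        let β = W + L * (m * 1) in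
        β + L * (m * 1) + L * n + L * (2 * n) + 3 * β + m + 2 * n + 2 * n + 2 * n + 16
          ≤ 4 * W + overhead m L * n
      queryBound-linear W = begin
        _                                  ≡⟨ regroup W m L n ⟩
        -- Since `n` is at least 1, the terms without `n` are absorbed.
        4 * W + (x + (3 * L + 6) * n)      ≤⟨ +-monoʳ-≤ (4 * W) (+-monoˡ-≤ _ (m≤m*n x n)) ⟩
        4 * W + (x * n + (3 * L + 6) * n)  ≡⟨ cong (4 * W +_) (*-distribʳ-+ n x (3 * L + 6)) ⟨
        4 * W + overhead m L * n           ∎
        where
        open ≤-Reasoning
        x = 5 * (m * L) + m + 16
        regroup : ∀ W m L n →
          (W + L * (m * 1)) + L * (m * 1) + L * n + L * (2 * n) + 3 * (W + L * (m * 1))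
            + m + 2 * n + 2 * n + 2 * n + 16
          ≡ 4 * W + (5 * (m * L) + m + 16 + (3 * L + 6) * n)
        regroup = solve-∀

    workingSpace≤ : .{{_ : NonZero n}} → ∀ coins q k k̃ →
                    workingSpace coins q k k̃ ≤ 4 * totalWeight coins + overhead m L * n
    workingSpace≤ coins q k k̃ = ≤-trans
      (max≤v⁺ z≤n (All.++⁺
        (All.map⁺ (All.map (λ {T} → construction≤ T) (states-φ coins)))
        (All.map⁺ (states-words final β (final-φ coins) q k k̃))))
      (queryBound-linear (totalWeight coins))
      where
      open Construct coins using (final; words)
      β = potentialBound coins
      construction≤ : ∀ T → total φ T ≤ β → words T ≤ queryBound final β (final-φ coins) q k k̃
      -- A construction state uses at most `β + 16` words. The eight other summands of `queryBound`
      -- are padding, so one bound serves both phases.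
      construction≤ T T≤β = +-monoˡ-≤ 16 (≤-trans (total-mono words≤φ T) (≤-trans T≤β
        (m≤n⇒m≤n+o _ (m≤n⇒m≤n+o _ (m≤n⇒m≤n+o _ (m≤n⇒m≤n+o _ (m≤n⇒m≤n+o _ (m≤n⇒m≤n+o _
          (m≤n⇒m≤n+o _ (m≤n⇒m≤n+o _ ≤-refl))))))))))

    additionalSpace≤ : .{{_ : NonZero n}} → ∀ coins q k k̃ →
      additionalSpace coins q k k̃ ≤ (L * (m * d) + d) * n + workingSpace coins q k k̃
    additionalSpace≤ coins q k k̃ = +-monoˡ-≤ (workingSpace coins q k k̃) (≤-trans
      (+-monoˡ-≤ d (total-const _ (λ _ → ≤-refl) u)) (m≤m*n (L * (m * d) + d) n))

  -- Potentials of the two simple indices: balanced trees first.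

  module _ {n : ℕ} where

    private
      module Tree = AVLIndexed (entryOrder F n)
      module Sets = AVLSets (entryOrder F n)
      V = Tree.const ⊤

      open AVLIndexed (entryOrder F n)
        using (Tree; leaf; node; key; [_]; _<_<_; _⊕_; _∼_⊔_; ∼+; ∼0; ∼-; 0#; 1#)

      W : ∀ {l u h} → Tree V l u h → ℕ
      W = nodeWords F n

    -- The cases follow those of `joinˡ⁺`: no growth, growth absorbed by the balance, single
    -- rotation, double rotation. A rotation relinks the same nodes, so only arithmetic remains.
    nodeWords-joinˡ⁺ : ∀ {l u hˡ hʳ h} (kv : Tree.K& V)
      (lk : Σ[ i ∈ Fin 2 ] Tree V l [ key kv ] (i ⊕ hˡ)) (ku : Tree V [ key kv ] u hʳ)
      (bal : hˡ ∼ hʳ ⊔ h) →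
      W (proj₂ (Tree.joinˡ⁺ kv lk ku bal)) ≡ 5 + W (proj₂ lk) + W ku
    nodeWords-joinˡ⁺ kv (0# , t₁) t₃ bal = refl
    nodeWords-joinˡ⁺ kv (1# , t₁) t₃ ∼0  = refl
    nodeWords-joinˡ⁺ kv (1# , t₁) t₃ ∼+  = refl
    nodeWords-joinˡ⁺ kv (1# , node k₂ t₁ t₃ ∼-) t₅ ∼- = rotate (W t₁) (W t₃) (W t₅)
      where
      rotate : ∀ x y z → 5 + x + (5 + y + z) ≡ 5 + (5 + x + y) + z
      rotate = solve-∀
    nodeWords-joinˡ⁺ kv (1# , node k₂ t₁ t₃ ∼0) t₅ ∼- = rotate (W t₁) (W t₃) (W t₅)
      where
      rotate : ∀ x y z → 5 + x + (5 + y + z) ≡ 5 + (5 + x + y) + z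
      rotate = solve-∀
    nodeWords-joinˡ⁺ kv (1# , node k₂ t₁ (node k₄ t₃ t₅ bal) ∼+) t₇ ∼- =
      rotate (W t₁) (W t₃) (W t₅) (W t₇)
      where
      rotate : ∀ w x y z → 5 + (5 + w + x) + (5 + y + z) ≡ 5 + (5 + w + (5 + x + y)) + z
      rotate = solve-∀

    nodeWords-joinʳ⁺ : ∀ {l u hˡ hʳ h} (kv : Tree.K& V)
      (lk : Tree V l [ key kv ] hˡ) (ku : Σ[ i ∈ Fin 2 ] Tree V [ key kv ] u (i ⊕ hʳ))
      (bal : hˡ ∼ hʳ ⊔ h) →
      W (proj₂ (Tree.joinʳ⁺ kv lk ku bal)) ≡ 5 + W lk + W (proj₂ ku)
    nodeWords-joinʳ⁺ kv t₁ (0# , t₃) bal = refl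
    nodeWords-joinʳ⁺ kv t₁ (1# , t₃) ∼0  = refl
    nodeWords-joinʳ⁺ kv t₁ (1# , t₃) ∼-  = refl
    nodeWords-joinʳ⁺ kv t₁ (1# , node k₄ t₃ t₅ ∼+) ∼+ = rotate (W t₁) (W t₃) (W t₅)
      where
      rotate : ∀ x y z → 5 + (5 + x + y) + z ≡ 5 + x + (5 + y + z)
      rotate = solve-∀
    nodeWords-joinʳ⁺ kv t₁ (1# , node k₄ t₃ t₅ ∼0) ∼+ = rotate (W t₁) (W t₃) (W t₅)
      where
      rotate : ∀ x y z → 5 + (5 + x + y) + z ≡ 5 + x + (5 + y + z)
      rotate = solve-∀
    nodeWords-joinʳ⁺ kv t₁ (1# , node k₆ (node k₄ t₃ t₅ bal) t₇ ∼-) ∼+ =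
      rotate (W t₁) (W t₃) (W t₅) (W t₇)
      where
      rotate : ∀ w x y z → 5 + (5 + w + x) + (5 + y + z) ≡ 5 + w + (5 + (5 + x + y) + z)
      rotate = solve-∀

    -- One leaf at most turns into a node of five words, and rebalancing on the way up is free. It
    -- is an inequality because meeting an equal key adds no node.
    nodeWords-insert : ∀ {l u h} k (x : Tree V l u h) (l<k<u : l < k < u) →
                       W (proj₂ (Tree.insert k _ x l<k<u)) ≤ 5 + W x
    nodeWords-insert k (leaf l<u) l<k<u = ≤-refl
    nodeWords-insert k (node kv lp pu bal) (l<k , k<u)
      with StrictTotalOrder.compare (entryOrder F n) k (key kv)
    ... | tri< k<k′ _ _ = begin
      _                ≡⟨ nodeWords-joinˡ⁺ kv (Tree.insert k _ lp _) pu bal ⟩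
      5 + W (proj₂ (Tree.insert k _ lp _)) + W pu
                       ≤⟨ +-monoˡ-≤ (W pu) (+-monoʳ-≤ 5 (nodeWords-insert k lp _)) ⟩
      5 + (5 + W lp + W pu) ∎
      where open ≤-Reasoning
    ... | tri> _ _ k′<k = begin
      _                ≡⟨ nodeWords-joinʳ⁺ kv lp (Tree.insert k _ pu _) bal ⟩
      5 + W lp + W (proj₂ (Tree.insert k _ pu _))
                       ≤⟨ +-monoʳ-≤ (5 + W lp) (nodeWords-insert k pu _) ⟩
      5 + W lp + (5 + W pu) ≡⟨ regroup (W lp) (W pu) ⟩
      5 + (5 + W lp + W pu) ∎
      where
      open ≤-Reasoning
      regroup : ∀ x y → 5 + x + (5 + y) ≡ 5 + (5 + x + y)
      regroup = solve-∀
    ... | tri≈ _ _ _ = m≤n+m (W (node kv lp pu bal)) 5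

    ∼⊔⇒≤+ : ∀ {i j h} → i ∼ j ⊔ h → h ≤ i + j
    ∼⊔⇒≤+ {i} {j} ∼+ = m≤n+m j i
    ∼⊔⇒≤+ {i} {j} ∼0 = m≤n+m j i
    ∼⊔⇒≤+ {i} {j} ∼- = m≤m+n i j

    -- A linear bound suffices for the path stack, so the maximum of the subtree heights may be
    -- replaced by their sum.
    height≤nodeWords : ∀ {l u h} (x : Tree V l u h) → h ≤ W x
    height≤nodeWords (leaf _)            = z≤n
    height≤nodeWords (node kv lk ku bal) = +-mono-≤ {1} {5} (s≤s z≤n)
      (≤-trans (∼⊔⇒≤+ bal) (+-mono-≤ (height≤nodeWords lk) (height≤nodeWords ku)))

    length-toDiffList : ∀ {l u h} (x : Tree V l u h) ys →
                        length (Tree.toDiffList x ys) ≤ W x + length ys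
    length-toDiffList (leaf _)            ys = ≤-refl
    length-toDiffList (node kv lk ku bal) ys = begin
      length (Tree.toDiffList lk (kv ∷ Tree.toDiffList ku ys))
        ≤⟨ length-toDiffList lk _ ⟩
      W lk + (1 + length (Tree.toDiffList ku ys))
        ≤⟨ +-monoʳ-≤ (W lk) (+-mono-≤ {1} {5} (s≤s z≤n) (length-toDiffList ku ys)) ⟩
      W lk + (5 + (W ku + length ys))
        ≡⟨ regroup (W lk) (W ku) (length ys) ⟩
      5 + W lk + W ku + length ys ∎
      where
      open ≤-Reasoning
      regroup : ∀ x y z → x + (5 + (y + z)) ≡ 5 + x + y + z
      regroup = solve-∀

    balancedTree-potential : Potential (balancedTree F n)
    balancedTree-potential = record
      { φ                = φ
      -- Twice the five words of a new node, since `φ` counts node words twice.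
      ; weight           = const 10
      ; φ-empty          = ≤-refl
      ; φ-insert         = λ _ → φ-insert
      ; words≤φ          = λ { (AVL.tree x) → ≤-trans
          (+-monoʳ-≤ (1 + W x) (height≤nodeWords x)) (≤-reflexive (double (W x))) }
      ; length-entries≤φ = length-entries≤φ
      }
      where
      -- One of the two copies of W x pays for the path stack, as long as the
      -- tree is high.
      φ : Sets.⟨Set⟩ → ℕ
      φ (AVL.tree x) = 1 + 2 * W x

      double : ∀ x → 1 + x + x ≡ 1 + 2 * x
      double = solve-∀

      φ-insert : ∀ e x → φ (Sets.insert e x) ≤ 10 + φ x
      φ-insert e (AVL.tree x) = ≤-trans
        (+-monoʳ-≤ 1 (*-monoʳ-≤ 2 (nodeWords-insert e x _)))
        (≤-reflexive (regroup (W x)))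
        where
        regroup : ∀ x → 1 + 2 * (5 + x) ≡ 10 + (1 + 2 * x)
        regroup = solve-∀

      length-entries≤φ : ∀ x → length (Sets.toList x) ≤ φ x
      length-entries≤φ (AVL.tree x) = begin
        length (Sets.toList (AVL.tree x))      ≡⟨ length-map _ (map _ (Tree.toDiffList x [])) ⟩
        length (map _ (Tree.toDiffList x []))  ≡⟨ length-map _ (Tree.toDiffList x []) ⟩
        length (Tree.toDiffList x [])          ≤⟨ length-toDiffList x [] ⟩
        W x + 0                                ≤⟨ +-monoʳ-≤ (W x) z≤n ⟩
        W x + (W x + 0)                        ≤⟨ n≤1+n _ ⟩
        1 + 2 * W x                            ∎
        where open ≤-Reasoning

    -- Skip lists.

    -- One height counts the node's own pointers; the other two bound its share
    -- of the header and the predecessor array, through max ≤ sum.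
    skipWeight : Entry F n × ℕ → ℕ
    skipWeight x = 4 + 3 * proj₂ x

    -- Insertion leaves the towers of the other nodes as they are, and a sum does not see where the
    -- new node is linked.
    skipWeight-insert : ∀ x ys → sum (map skipWeight (skipInsert F x ys)) ≡
                                 skipWeight x + sum (map skipWeight ys)
    skipWeight-insert x []       = refl
    skipWeight-insert x (y ∷ ys)
      with does (StrictTotalOrder._<?_ (entryOrder F n) (proj₁ y) (proj₁ x))
    ... | false = refl
    ... | true  = trans (cong (skipWeight y +_) (skipWeight-insert x ys))
                        (swap (skipWeight y) (skipWeight x) _)
      where
      swap : ∀ x y z → x + (y + z) ≡ y + (x + z)
      swap = solve-∀

    skipWords≤ : ∀ xs → skipWords F xs ≤ 1 + sum (map skipWeight xs)
    skipWords≤ xs = +-monoʳ-≤ 1 (begin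
      sum (map (λ x → 4 + proj₂ x) xs) + 2 * max 0 (map proj₂ xs)
        ≤⟨ +-monoʳ-≤ (sum (map (λ x → 4 + proj₂ x) xs))
             (*-monoʳ-≤ 2 (max≤v⁺ z≤n (All-≤-sum (map proj₂ xs)))) ⟩
      sum (map (λ x → 4 + proj₂ x) xs) + 2 * sum (map proj₂ xs)
        ≡⟨ cong (sum (map (λ x → 4 + proj₂ x) xs) +_)
             (trans (*-comm 2 (sum (map proj₂ xs))) (sym (sum-map-*ʳ proj₂ 2 xs))) ⟩
      sum (map (λ x → 4 + proj₂ x) xs) + sum (map (λ x → proj₂ x * 2) xs)
        ≡⟨ sum-map-+ (λ x → 4 + proj₂ x) (λ x → proj₂ x * 2) xs ⟨
      sum (map (λ x → 4 + proj₂ x + proj₂ x * 2) xs)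
        ≤⟨ sum-map-≤ (λ x → ≤-reflexive (regroup (proj₂ x))) xs ⟩
      sum (map skipWeight xs) ∎)
      where
      open ≤-Reasoning
      regroup : ∀ h → 4 + h + h * 2 ≡ 4 + 3 * h
      regroup = solve-∀

    skipList-potential : ∀ H → Potential (skipList F H n)
    skipList-potential H = record
      { φ                = λ xs → 1 + sum (map skipWeight xs)
      ; weight           = λ r → 4 + 3 * height F r
      ; φ-empty          = ≤-refl
      ; φ-insert         = λ r e xs → ≤-reflexive
          (trans (cong suc (skipWeight-insert (e , height F r) xs))
                 (sym (+-suc (4 + 3 * height F r) _)))
      ; words≤φ          = skipWords≤
      ; length-entries≤φ = length≤
      }
      where
      length≤ : ∀ xs → length (map proj₁ xs) ≤ 1 + sum (map skipWeight xs)
      length≤ []       = z≤n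
      -- One unit of the node's weight pays for its entry.
      length≤ (x ∷ xs) = s≤s (≤-trans (length≤ xs) (s≤s (m≤n+m _ (3 + 3 * proj₂ x))))

-- Linear space for both kinds of index.

theorem11 : ∀ {c ℓ₁ ℓ₂} (F : EuclideanField c ℓ₁ ℓ₂)
    (m L : ℕ) .{{_ : NonZero m}} .{{_ : NonZero L}} →
    (Σ[ a ∈ ℕ ] (∀ (d : ℕ) → Σ[ b ∈ ℕ ]
    (∀ (n : ℕ) .{{_ : NonZero n}} (D : Vec (Point F d) n)
    (u : Table m L (UnitVector F d)) (q : Point F d) (k k̃ : ℕ) →
    let open Algorithm F (balancedTree F n) D u in
    (coins : Table m L (Vec ⊤ n)) →
    (workingSpace coins q k k̃ ≤ a * n) ×
    (additionalSpace coins q k k̃ ≤ b * n))))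
    ×
    (Σ[ a ∈ ℕ ] (∀ (d : ℕ) → Σ[ b ∈ ℕ ]
    (∀ (n : ℕ) .{{_ : NonZero n}} (D : Vec (Point F d) n)
    (u : Table m L (UnitVector F d)) (q : Point F d) (k k̃ : ℕ) (H : ℕ) →
    let open Algorithm F (skipList F H n) D u in
    MeanAtMost (coinFlips H n m L)
    (λ coins → workingSpace coins q k k̃) (a * n) ×
    MeanAtMost (coinFlips H n m L)
    (λ coins → additionalSpace coins q k k̃) (b * n))))
theorem11 F m L =
  (α , λ d → L * (m * d) + d + α , balanced d) ,
  (α , λ d → L * (m * d) + d + α , skip d)
  where
  α : ℕ
  -- One constant fits both kinds: an insertion weighs 10 = 2 · 5 in a balanced tree and has mean
  -- weight 4 + 3 · 2 = 10 in a skip list. The factor 4 counts the indices once and a ranking of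
  -- three words per cell.
  α = 4 * (m * L * 10) + overhead m L

  linear : ∀ n → 4 * (m * (L * n) * 10) + overhead m L * n ≡ α * n
  linear n = regroup m L n (overhead m L)
    where
    regroup : ∀ m L n o → 4 * (m * (L * n) * 10) + o * n ≡ (4 * (m * L * 10) + o) * n
    regroup = solve-∀

  balanced : ∀ d n .{{_ : NonZero n}} (D : Vec (Point F d) n)
    (u : Table m L (UnitVector F d)) q k k̃ (coins : Table m L (Vec ⊤ n)) →
    let open Algorithm F (balancedTree F n) D u in
    (workingSpace coins q k k̃ ≤ α * n) ×
    (additionalSpace coins q k k̃ ≤ (L * (m * d) + d + α) * n)
  balanced d n D u q k k̃ coins = working , (begin
    _                                    ≤⟨ additionalSpace≤ coins q k k̃ ⟩
    _                                    ≤⟨ +-monoʳ-≤ ((L * (m * d) + d) * n) working ⟩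
    (L * (m * d) + d) * n + α * n        ≡⟨ *-distribʳ-+ n (L * (m * d) + d) α ⟨
    (L * (m * d) + d + α) * n            ∎)
    where
    open ≤-Reasoning
    open Algorithm F (balancedTree F n) D u
    open Space {F = F} balancedTree-potential D u
    working : workingSpace coins q k k̃ ≤ α * n
    working = begin
      workingSpace coins q k k̃
        ≤⟨ workingSpace≤ coins q k k̃ ⟩
      4 * totalWeight coins + overhead m L * n
        ≡⟨ cong (λ x → 4 * x + overhead m L * n)
             (trans (sum-map-const 10 (insertions m L n))
                    (*-comm 10 (length (insertions m L n)))) ⟩
      4 * (length (insertions m L n) * 10) + overhead m L * n
        ≡⟨ cong (λ x → 4 * (x * 10) + overhead m L * n) (length-insertions m L n) ⟩
      4 * (m * (L * n) * 10) + overhead m L * n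
        ≡⟨ linear n ⟩
      α * n ∎

  skip : ∀ d n .{{_ : NonZero n}} (D : Vec (Point F d) n)
    (u : Table m L (UnitVector F d)) q k k̃ H →
    let open Algorithm F (skipList F H n) D u in
    MeanAtMost (coinFlips H n m L) (λ coins → workingSpace coins q k k̃) (α * n) ×
    MeanAtMost (coinFlips H n m L) (λ coins → additionalSpace coins q k k̃)
      ((L * (m * d) + d + α) * n)
  skip d n D u q k k̃ H = bound working ,
    bound (subst (Mean flips _) (sym (*-distribʳ-+ n (L * (m * d) + d) α))
      (mean-mono (λ coins → additionalSpace≤ coins q k k̃)
        (mean-+ (mean-const _) working)))
    where
    open Algorithm F (skipList F H n) D u
    open Space {F = F} (skipList-potential H) D u
    flips = coinFlips H n m L

    weight-mean : ∀ x → Mean flips (λ coins → insertionWeight coins x) 10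
    -- One `mean-lookup` for each level of the coin table: point, simple index, composite index.
    weight-mean (j , l , i) = mean-lookup (mean-lookup (mean-lookup
      (mean-+ (mean-const 4) (mean-* 3 (mean-height F H))) i) j) l

    totalWeight-mean : Mean flips totalWeight (m * (L * n) * 10)
    totalWeight-mean = subst (λ x → Mean flips totalWeight (x * 10))
      (length-insertions m L n) (mean-sum weight-mean (insertions m L n))

    working : Mean flips (λ coins → workingSpace coins q k k̃) (α * n)
    working = subst (Mean flips _) (linear n)
      -- The peak over all states is bounded outcome by outcome before averaging, so this bounds the
      -- mean of the peak rather than the peak of the means.
      (mean-mono (λ coins → workingSpace≤ coins q k k̃)
        (mean-+ (mean-* 4 totalWeight-mean) (mean-const _)))
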